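{- For integers $j\ge1$ define functions on $x>-1$ by $f_{0,j}(x)=\ln^j(1+x)$ and $f_{n,j}(x)=\int_0^x f_{n-1,j}(t)\,dt$ for $n\ge1$, and write (uniquely) $$f_{n,j}(x)=A_{n,j}(x)+\sum_{k=1}^{j}B_{n,k,j}(x)\ln^k(1+x)$$ with polynomials $A_{n,j}$, $B_{n,k,j}$. Then for all $n\ge0$ and $j\ge1$, $$A_{n,j}(x)=\frac{(-1)^j\,j!}{n!}\sum_{r=1}^{n}\binom{n}{r}\left[\sum_{k=0}^{r-1}\frac{H_{n-k,j-1}}{n-k}\right]x^r.$$
   Context: For $n\ge0$, $m\ge0$, $H_{n,m}=\sum_{1\le a_1\le a_2\le\cdots\le a_m\le n}\frac{1}{a_1a_2\cdots a_m}$, the sum over all nondecreasing $m$-tuples with entries in $\{1,\dots,n\}$; thus $H_{n,0}=1$ for all $n\ge0$ and $H_{0,m}=0$ for $m\ge1$. -}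

module Defs where

open import Data.Nat as ℕ using (ℕ; zero; suc; _≤_; _∸_; _≤ᵇ_)
open import Data.Nat.Combinatorics using (_C_)
open import Data.Nat using (_!)
open import Data.Integer as ℤ using (ℤ)
open import Data.Rational using (ℚ; 0ℚ; 1ℚ; _+_; _*_; -_; _/_)
open import Data.Bool using (Bool; true; false; _∧_; if_then_else_)
open import Data.List using (List; []; _∷_; map; concatMap; upTo; filter; foldr)
open import Data.Product using (∃; _×_)
open import Data.Sum using (_⊎_)
open import Relation.Binary.PropositionalEquality using (_≡_)
open import Relation.Nullary.Decidable using (yes; no)
open import Data.Bool using (T?)

ℕ→ℚ : ℕ → ℚ
ℕ→ℚ n = ℤ.+ n / 1

-- reciprocal 1/d of a natural number (only used with d ≥ 1; 1/0 := 0)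
inv : ℕ → ℚ
inv zero    = 0ℚ
inv (suc d) = ℤ.+ 1 / suc d

sgn : ℕ → ℚ
sgn zero    = 1ℚ
sgn (suc j) = - sgn j

-- Σ_{i=a}^{b} g i  (empty if b < a)
sumFromTo : ℕ → ℕ → (ℕ → ℚ) → ℚ
sumFromTo a b g = foldr (λ i s → g (a ℕ.+ i) + s) 0ℚ (upTo (suc b ∸ a))

tuples : ℕ → ℕ → List (List ℕ)
tuples n zero    = [] ∷ []
tuples n (suc m) = concatMap (λ a → map (a ∷_) (tuples n m)) (map suc (upTo n))

nondecreasing : List ℕ → Bool
nondecreasing []           = true
nondecreasing (a ∷ [])     = true
nondecreasing (a ∷ b ∷ xs) = (a ≤ᵇ b) ∧ nondecreasing (b ∷ xs)

prodℕ : List ℕ → ℕ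
prodℕ = foldr ℕ._*_ 1

H : ℕ → ℕ → ℚ
H n m = foldr (λ t s → inv (prodℕ t) + s) 0ℚ
          (filter (λ t → T? (nondecreasing t)) (tuples n m))

-- Formal model of the functions  Σ_{r,k} c(r,k) x^r ln^k(1+x).
-- An expression is its coefficient array  c : ℕ → ℕ → ℚ,
-- c r k = coefficient of x^r L^k, where L = ln(1+x); it must have finite support.
Expr : Set
Expr = ℕ → ℕ → ℚ

FiniteSupport : Expr → Set
FiniteSupport c = ∃ λ N → ∀ r k → N ≤ r ⊎ N ≤ k → c r k ≡ 0ℚ

-- (1+x)·(d/dx) of an expression.  Since d/dx (x^m L^k) = m x^(m-1) L^k + k x^m L^(k-1)/(1+x),
-- the coefficient of x^r L^k in (1+x)·c' is
--   (r+1) c(r+1,k) + r c(r,k) + (k+1) c(r,k+1).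
D1x : Expr → Expr
D1x c r k = ℕ→ℚ (suc r) * c (suc r) k + ℕ→ℚ r * c r k + ℕ→ℚ (suc k) * c r (suc k)

mul1x : Expr → Expr
mul1x c zero    k = c zero k
mul1x c (suc r) k = c (suc r) k + c r k

-- value at x = 0 (where L = ln 1 = 0)
at0 : Expr → ℚ
at0 c = c 0 0

Lpow : ℕ → Expr
Lpow j r k with r ℕ.≟ 0 | k ℕ.≟ j
... | yes _ | yes _ = 1ℚ
... | _     | _     = 0ℚ

-- F is the family f_{n,j} (n = 0,1,2,…) for fixed j:
-- f_{0,j} = ln^j(1+x), and f_{n+1,j} is the antiderivative of f_{n,j} vanishing at 0,
-- i.e. f_{n+1,j}' = f_{n,j} (stated after multiplying by 1+x) and f_{n+1,j}(0) = 0.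
IsIntegralFamily : ℕ → (ℕ → Expr) → Set
IsIntegralFamily j F =
  (∀ n → FiniteSupport (F n)) ×
  ((∀ r k → F 0 r k ≡ Lpow j r k) ×
  ((∀ n r k → D1x (F (suc n)) r k ≡ mul1x (F n) r k) ×
   (∀ n → at0 (F (suc n)) ≡ 0ℚ)))

-- A_{n,j} is the L^0-part: its x^r coefficient is F n r 0.
-- Claimed coefficient of x^r in A_{n,j}:
--  (-1)^j j!/n! · C(n,r) · Σ_{k=0}^{r-1} H_{n-k,j-1}/(n-k)   for 1 ≤ r ≤ n, and 0 otherwise.
Acoeff : ℕ → ℕ → ℕ → ℚ
Acoeff n j zero = 0ℚ
Acoeff n j (suc r') =
  if suc r' ≤ᵇ n
  then sgn j * ℕ→ℚ (j !) * inv (n !) * ℕ→ℚ (n C suc r')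
         * sumFromTo 0 r' (λ k → H (n ∸ k) (j ∸ 1) * inv (n ∸ k))
  else 0ℚ

{-# OPTIONS --safe #-}
-- A finitely supported expression that is killed by (1+x) d/dx and vanishes at 0 is zero: its
-- coefficients vanish from the outside in.  Hence the family f_{n,j} is unique, and it suffices
-- to exhibit one solution, namely
--   f_{n,j} = A_{n,j}(x) + Σ_{k=1}^{j} (-1)^{j-k} j!/(k! n!) H_{n,j-k} (1+x)^n ln^k(1+x).
-- In the logarithmic columns the defining recursion reduces to
-- H_{n+1,m+1} = H_{n,m+1} + H_{n+1,m}/(n+1) (a nondecreasing tuple in {1..n+1} either avoids n+1
-- or ends with it); in the polynomial column it reduces to the absorption identity
-- (r+1) C(n+1,r+1) = (n+1) C(n,r) and Pascal's rule, the harmonic terms cancelling.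
module Submission where

open import Defs
open import Data.Nat as ℕ using (ℕ; zero; suc; _!; _∸_; _≤_; _<_; _≤ᵇ_; _≥_)
import Data.Nat.Properties as ℕ
open import Data.Nat.Combinatorics using (_C_; nCk+nC[k+1]≡[n+1]C[k+1]; nC1≡n; k>n⇒nCk≡0)
import Data.Nat.Tactic.RingSolver as ℕ-Solver
import Data.Integer as ℤ
import Data.Integer.Properties as ℤ
import Data.Nat.Coprimality as Coprime
open import Data.Rational using (ℚ; mkℚ; 0ℚ; 1ℚ; _+_; _*_; _-_; -_)
open import Data.Rational.Properties
open import Data.Bool using (Bool; true; false; if_then_else_; T?)
open import Data.Bool.Properties using (T-≡)
open import Data.List using (List; []; _∷_; _++_; map; concatMap; filter; foldr; upTo; applyUpTo)
import Data.List.Properties as List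
open import Data.Maybe using (just; nothing)
open import Data.Product using (_,_)
open import Data.Sum using (_⊎_; inj₁; inj₂)
open import Function.Bundles using (Equivalence)
open import Relation.Nullary using (yes; no; contradiction)
open import Relation.Binary.Definitions using (tri<; tri≈; tri>)
open import Relation.Binary.PropositionalEquality hiding (J)
open import Tactic.RingSolver using (solve-∀)
open import Tactic.RingSolver.Core.AlmostCommutativeRing using (AlmostCommutativeRing; fromCommutativeRing)

ℚ-ring : AlmostCommutativeRing _ _
ℚ-ring = fromCommutativeRing +-*-commutativeRing isZero?
  where
  isZero? : ∀ x → _
  isZero? x with 0ℚ ≟ x
  ... | yes x≡0 = just x≡0
  ... | no _    = nothing

ℕ→ℚ≡mkℚ : ∀ n → ℕ→ℚ n ≡ mkℚ (ℤ.+ n) 0 (Coprime.sym (Coprime.1-coprimeTo n))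
ℕ→ℚ≡mkℚ n = normalize-coprime (Coprime.sym (Coprime.1-coprimeTo n))

ℕ→ℚ-homo-+ : ∀ m n → ℕ→ℚ (m ℕ.+ n) ≡ ℕ→ℚ m + ℕ→ℚ n
ℕ→ℚ-homo-+ m n = trans (/-cong numerators refl) (sym (cong₂ _+_ (ℕ→ℚ≡mkℚ m) (ℕ→ℚ≡mkℚ n)))
  where
  numerators : ℤ.+ (m ℕ.+ n) ≡ ℤ.+ m ℤ.* ℤ.+ 1 ℤ.+ ℤ.+ n ℤ.* ℤ.+ 1
  numerators = trans (ℤ.pos-+ m n) (sym (cong₂ ℤ._+_ (ℤ.*-identityʳ (ℤ.+ m)) (ℤ.*-identityʳ (ℤ.+ n))))

ℕ→ℚ-homo-* : ∀ m n → ℕ→ℚ (m ℕ.* n) ≡ ℕ→ℚ m * ℕ→ℚ n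
ℕ→ℚ-homo-* m n = trans (/-cong (ℤ.pos-* m n) refl) (sym (cong₂ _*_ (ℕ→ℚ≡mkℚ m) (ℕ→ℚ≡mkℚ n)))

inv≡mkℚ : ∀ n → inv (suc n) ≡ mkℚ (ℤ.+ 1) n (Coprime.1-coprimeTo (suc n))
inv≡mkℚ n = normalize-coprime (Coprime.1-coprimeTo (suc n))

ℕ→ℚ*inv≡1 : ∀ n .{{_ : ℕ.NonZero n}} → ℕ→ℚ n * inv n ≡ 1ℚ
ℕ→ℚ*inv≡1 (suc n) = trans (cong₂ _*_ (ℕ→ℚ≡mkℚ (suc n)) (inv≡mkℚ n))
                           (*-inverseʳ (mkℚ (ℤ.+ suc n) 0 (Coprime.sym (Coprime.1-coprimeTo (suc n)))))

inv*ℕ→ℚ≡1 : ∀ n .{{_ : ℕ.NonZero n}} → inv n * ℕ→ℚ n ≡ 1ℚ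
inv*ℕ→ℚ≡1 n = trans (*-comm (inv n) (ℕ→ℚ n)) (ℕ→ℚ*inv≡1 n)

ℕ→ℚ*x≡y⇒x≡inv*y : ∀ n .{{_ : ℕ.NonZero n}} x y → ℕ→ℚ n * x ≡ y → x ≡ inv n * y
ℕ→ℚ*x≡y⇒x≡inv*y n x y nx≡y = begin
  x                    ≡⟨ *-identityˡ x ⟨
  1ℚ * x               ≡⟨ cong (_* x) (inv*ℕ→ℚ≡1 n) ⟨
  (inv n * ℕ→ℚ n) * x ≡⟨ *-assoc (inv n) (ℕ→ℚ n) x ⟩
  inv n * (ℕ→ℚ n * x) ≡⟨ cong (inv n *_) nx≡y ⟩
  inv n * y            ∎
  where open ≡-Reasoning

ℕ→ℚ*x≡0⇒x≡0 : ∀ n .{{_ : ℕ.NonZero n}} x → ℕ→ℚ n * x ≡ 0ℚ → x ≡ 0ℚ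
ℕ→ℚ*x≡0⇒x≡0 n x nx≡0 = trans (ℕ→ℚ*x≡y⇒x≡inv*y n x 0ℚ nx≡0) (*-zeroʳ (inv n))

inv-homo-* : ∀ m n → inv (m ℕ.* n) ≡ inv m * inv n
inv-homo-* zero    n       = sym (*-zeroˡ (inv n))
inv-homo-* (suc m) zero    = trans (cong inv (ℕ.*-zeroʳ m)) (sym (*-zeroʳ (inv (suc m))))
inv-homo-* (suc m) (suc n) = sym (trans (ℕ→ℚ*x≡y⇒x≡inv*y (suc m ℕ.* suc n) _ 1ℚ product) (*-identityʳ _))
  where
  open ≡-Reasoning
  product : ℕ→ℚ (suc m ℕ.* suc n) * (inv (suc m) * inv (suc n)) ≡ 1ℚ
  product = begin
    ℕ→ℚ (suc m ℕ.* suc n) * (inv (suc m) * inv (suc n))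
      ≡⟨ cong (_* (inv (suc m) * inv (suc n))) (ℕ→ℚ-homo-* (suc m) (suc n)) ⟩
    (ℕ→ℚ (suc m) * ℕ→ℚ (suc n)) * (inv (suc m) * inv (suc n))
      ≡⟨ interchange (ℕ→ℚ (suc m)) (ℕ→ℚ (suc n)) (inv (suc m)) (inv (suc n)) ⟩
    (ℕ→ℚ (suc m) * inv (suc m)) * (ℕ→ℚ (suc n) * inv (suc n))
      ≡⟨ cong₂ _*_ (ℕ→ℚ*inv≡1 (suc m)) (ℕ→ℚ*inv≡1 (suc n)) ⟩
    1ℚ ∎
    where
    interchange : ∀ a b c d → (a * b) * (c * d) ≡ (a * c) * (b * d)
    interchange = solve-∀ ℚ-ring

inv-suc! : ∀ n → inv (suc n !) ≡ inv (suc n) * inv (n !)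
inv-suc! n = inv-homo-* (suc n) (n !)

ℕ→ℚ*inv-suc! : ∀ n → ℕ→ℚ (suc n) * inv (suc n !) ≡ inv (n !)
ℕ→ℚ*inv-suc! n = begin
  ℕ→ℚ (suc n) * inv (suc n !)             ≡⟨ cong (ℕ→ℚ (suc n) *_) (inv-suc! n) ⟩
  ℕ→ℚ (suc n) * (inv (suc n) * inv (n !)) ≡⟨ *-assoc (ℕ→ℚ (suc n)) (inv (suc n)) (inv (n !)) ⟨
  (ℕ→ℚ (suc n) * inv (suc n)) * inv (n !) ≡⟨ cong (_* inv (n !)) (ℕ→ℚ*inv≡1 (suc n)) ⟩
  1ℚ * inv (n !)                           ≡⟨ *-identityˡ (inv (n !)) ⟩
  inv (n !)                                ∎
  where open ≡-Reasoning

if-≤ᵇ-yes : ∀ {m n} {A : Set} {x y : A} → m ≤ n → (if m ≤ᵇ n then x else y) ≡ x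
if-≤ᵇ-yes m≤n rewrite Equivalence.to T-≡ (ℕ.≤⇒≤ᵇ m≤n) = refl

if-≤ᵇ-no : ∀ {m n} {A : Set} {x y : A} → n < m → (if m ≤ᵇ n then x else y) ≡ y
if-≤ᵇ-no {m} {n} n<m with m ≤ᵇ n in m≤ᵇn
... | true  = contradiction (ℕ.≤ᵇ⇒≤ m n (Equivalence.from T-≡ m≤ᵇn)) (ℕ.<⇒≱ n<m)
... | false = refl

cong₃ : ∀ {A B C D : Set} (f : A → B → C → D) {a a′ b b′ c c′} → a ≡ a′ → b ≡ b′ → c ≡ c′ → f a b c ≡ f a′ b′ c′
cong₃ f refl refl refl = refl

private variable A B : Set

sumOver : (A → ℚ) → List A → ℚ
sumOver g = foldr (λ x s → g x + s) 0ℚ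

sumOver-++ : ∀ (g : A → ℚ) xs ys → sumOver g (xs ++ ys) ≡ sumOver g xs + sumOver g ys
sumOver-++ g []       ys = sym (+-identityˡ _)
sumOver-++ g (x ∷ xs) ys = trans (cong (g x +_) (sumOver-++ g xs ys)) (sym (+-assoc (g x) _ _))

sumOver-cong : ∀ {g h : A → ℚ} → (∀ x → g x ≡ h x) → ∀ xs → sumOver g xs ≡ sumOver h xs
sumOver-cong g≗h []       = refl
sumOver-cong g≗h (x ∷ xs) = cong₂ _+_ (g≗h x) (sumOver-cong g≗h xs)

sumOver-*ˡ : ∀ c (g : A → ℚ) xs → sumOver (λ x → c * g x) xs ≡ c * sumOver g xs
sumOver-*ˡ c g []       = sym (*-zeroʳ c)
sumOver-*ˡ c g (x ∷ xs) = trans (cong (c * g x +_) (sumOver-*ˡ c g xs)) (sym (*-distribˡ-+ c (g x) _))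

sumOver-zero : ∀ (xs : List A) → sumOver (λ _ → 0ℚ) xs ≡ 0ℚ
sumOver-zero []       = refl
sumOver-zero (x ∷ xs) = trans (+-identityˡ _) (sumOver-zero xs)

sumOver-filter : ∀ (p : A → Bool) g xs →
                 sumOver g (filter (λ x → T? (p x)) xs) ≡ sumOver (λ x → if p x then g x else 0ℚ) xs
sumOver-filter p g []       = refl
sumOver-filter p g (x ∷ xs) with p x
... | true  = cong (g x +_) (sumOver-filter p g xs)
... | false = trans (sumOver-filter p g xs) (sym (+-identityˡ _))

sumOver-map : ∀ (g : B → ℚ) (f : A → B) xs → sumOver g (map f xs) ≡ sumOver (λ x → g (f x)) xs
sumOver-map g f []       = refl
sumOver-map g f (x ∷ xs) = cong (g (f x) +_) (sumOver-map g f xs)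

sumOver-concatMap : ∀ (g : B → ℚ) (f : A → List B) xs →
                    sumOver g (concatMap f xs) ≡ sumOver (λ x → sumOver g (f x)) xs
sumOver-concatMap g f []       = refl
sumOver-concatMap g f (x ∷ xs) =
  trans (sumOver-++ g (f x) (concatMap f xs)) (cong (sumOver g (f x) +_) (sumOver-concatMap g f xs))

sumBelow : ℕ → (ℕ → ℚ) → ℚ
sumBelow zero    g = 0ℚ
sumBelow (suc r) g = g 0 + sumBelow r (λ i → g (suc i))

sumOver-applyUpTo : ∀ g (f : ℕ → A) m → sumOver g (applyUpTo f m) ≡ sumBelow m (λ i → g (f i))
sumOver-applyUpTo g f zero    = refl
sumOver-applyUpTo g f (suc m) = cong (g (f 0) +_) (sumOver-applyUpTo g (λ i → f (suc i)) m)

sumTo : ℕ → (ℕ → ℚ) → ℚ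
sumTo zero    g = 0ℚ
sumTo (suc n) g = sumTo n g + g (suc n)

sumOver-upTo : ∀ n g → sumOver g (map suc (upTo n)) ≡ sumTo n g
sumOver-upTo zero    g = refl
sumOver-upTo (suc n) g = begin
  sumOver g (map suc (upTo (suc n)))             ≡⟨ cong (λ bs → sumOver g (map suc bs)) (List.upTo-∷ʳ n) ⟨
  sumOver g (map suc (upTo n ++ n ∷ []))         ≡⟨ cong (sumOver g) (List.map-++ suc (upTo n) (n ∷ [])) ⟩
  sumOver g (map suc (upTo n) ++ suc n ∷ [])     ≡⟨ sumOver-++ g (map suc (upTo n)) (suc n ∷ []) ⟩
  sumOver g (map suc (upTo n)) + (g (suc n) + 0ℚ) ≡⟨ cong₂ _+_ (sumOver-upTo n g) (+-identityʳ (g (suc n))) ⟩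
  sumTo n g + g (suc n)                            ∎
  where open ≡-Reasoning

sumTo-cong : ∀ n {g h} → (∀ b → b ≤ n → g b ≡ h b) → sumTo n g ≡ sumTo n h
sumTo-cong zero    g≗h = refl
sumTo-cong (suc n) g≗h = cong₂ _+_ (sumTo-cong n (λ b b≤n → g≗h b (ℕ.m≤n⇒m≤1+n b≤n))) (g≗h (suc n) ℕ.≤-refl)

sumTo-zero : ∀ n g → (∀ b → b ≤ n → g b ≡ 0ℚ) → sumTo n g ≡ 0ℚ
sumTo-zero n g g≡0 = trans (sumTo-cong n g≡0) (sumTo-const0 n)
  where
  sumTo-const0 : ∀ n → sumTo n (λ _ → 0ℚ) ≡ 0ℚ
  sumTo-const0 zero    = refl
  sumTo-const0 (suc n) = trans (+-identityʳ _) (sumTo-const0 n)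

sumTo-+ : ∀ n g h → sumTo n (λ b → g b + h b) ≡ sumTo n g + sumTo n h
sumTo-+ zero    g h = refl
sumTo-+ (suc n) g h = trans (cong (_+ (g (suc n) + h (suc n))) (sumTo-+ n g h))
                            (interchange (sumTo n g) (sumTo n h) (g (suc n)) (h (suc n)))
  where
  interchange : ∀ a b c d → (a + b) + (c + d) ≡ (a + c) + (b + d)
  interchange = solve-∀ ℚ-ring

sumTo-*ˡ : ∀ n c g → sumTo n (λ b → c * g b) ≡ c * sumTo n g
sumTo-*ˡ zero    c g = sym (*-zeroʳ c)
sumTo-*ˡ (suc n) c g = trans (cong (_+ c * g (suc n)) (sumTo-*ˡ n c g)) (sym (*-distribˡ-+ c _ _))

-- Multiple harmonic-star sums

summand≥ : ℕ → List ℕ → ℚ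
summand≥ a t = if nondecreasing (a ∷ t) then inv (prodℕ t) else 0ℚ

H≥ : ℕ → ℕ → ℕ → ℚ
H≥ n a m = sumOver (summand≥ a) (tuples n m)

H≡H≥0 : ∀ n m → H n m ≡ H≥ n 0 m
H≡H≥0 n m = trans (sumOver-filter nondecreasing (λ t → inv (prodℕ t)) (tuples n m))
                  (sumOver-cong summand≥-0 (tuples n m))
  where
  summand≥-0 : ∀ t → (if nondecreasing t then inv (prodℕ t) else 0ℚ) ≡ summand≥ 0 t
  summand≥-0 []      = refl
  summand≥-0 (b ∷ t) = refl

firstEntryTerm : ℕ → ℕ → ℕ → ℕ → ℚ
firstEntryTerm n a m b = if a ≤ᵇ b then inv b * H≥ n b m else 0ℚ

summand≥-∷ : ∀ a b t → summand≥ a (b ∷ t) ≡ (if a ≤ᵇ b then inv b * summand≥ b t else 0ℚ)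
summand≥-∷ a b t with a ≤ᵇ b | nondecreasing (b ∷ t)
... | true  | true  = inv-homo-* b (prodℕ t)
... | true  | false = sym (*-zeroʳ (inv b))
... | false | _     = refl

H≥-firstEntry : ∀ n a m → H≥ n a (suc m) ≡ sumTo n (firstEntryTerm n a m)
H≥-firstEntry n a m = begin
  sumOver (summand≥ a) (concatMap (λ b → map (b ∷_) (tuples n m)) (map suc (upTo n)))
    ≡⟨ sumOver-concatMap (summand≥ a) _ (map suc (upTo n)) ⟩
  sumOver (λ b → sumOver (summand≥ a) (map (b ∷_) (tuples n m))) (map suc (upTo n))
    ≡⟨ sumOver-cong startingWith (map suc (upTo n)) ⟩
  sumOver (firstEntryTerm n a m) (map suc (upTo n))
    ≡⟨ sumOver-upTo n (firstEntryTerm n a m) ⟩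
  sumTo n (firstEntryTerm n a m) ∎
  where
  open ≡-Reasoning
  startingWith : ∀ b → sumOver (summand≥ a) (map (b ∷_) (tuples n m)) ≡ firstEntryTerm n a m b
  startingWith b = begin
    sumOver (summand≥ a) (map (b ∷_) (tuples n m))
      ≡⟨ sumOver-map (summand≥ a) (b ∷_) (tuples n m) ⟩
    sumOver (λ t → summand≥ a (b ∷ t)) (tuples n m)
      ≡⟨ sumOver-cong (summand≥-∷ a b) (tuples n m) ⟩
    sumOver (λ t → if a ≤ᵇ b then inv b * summand≥ b t else 0ℚ) (tuples n m)
      ≡⟨ pullOut (a ≤ᵇ b) ⟩
    firstEntryTerm n a m b ∎
    where
    pullOut : ∀ c → sumOver (λ t → if c then inv b * summand≥ b t else 0ℚ) (tuples n m)
                    ≡ (if c then inv b * H≥ n b m else 0ℚ)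
    pullOut true  = sumOver-*ˡ (inv b) (summand≥ b) (tuples n m)
    pullOut false = sumOver-zero (tuples n m)

firstEntryTerm-top : ∀ n a m → a ≤ suc n → firstEntryTerm (suc n) a m (suc n) ≡ inv (suc n) * H≥ (suc n) (suc n) m
firstEntryTerm-top n a m a≤1+n = if-≤ᵇ-yes a≤1+n

H≥-top : ∀ n m → H≥ (suc n) (suc n) (suc m) ≡ inv (suc n) * H≥ (suc n) (suc n) m
H≥-top n m = begin
  H≥ (suc n) (suc n) (suc m)
    ≡⟨ H≥-firstEntry (suc n) (suc n) m ⟩
  sumTo n (firstEntryTerm (suc n) (suc n) m) + firstEntryTerm (suc n) (suc n) m (suc n)
    ≡⟨ cong₂ _+_ (sumTo-zero n _ (λ b b≤n → if-≤ᵇ-no (ℕ.s≤s b≤n))) (firstEntryTerm-top n (suc n) m ℕ.≤-refl) ⟩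
  0ℚ + inv (suc n) * H≥ (suc n) (suc n) m
    ≡⟨ +-identityˡ _ ⟩
  inv (suc n) * H≥ (suc n) (suc n) m ∎
  where open ≡-Reasoning

H≥-extendRange : ∀ n m a → a ≤ suc n →
               H≥ (suc n) a (suc m) ≡ H≥ n a (suc m) + inv (suc n) * H≥ (suc n) a m
H≥-extendRange n zero a a≤1+n = begin
  H≥ (suc n) a 1                                      ≡⟨ H≥-firstEntry (suc n) a 0 ⟩
  sumTo n (firstEntryTerm n a 0) + firstEntryTerm (suc n) a 0 (suc n) ≡⟨ cong (sumTo n (firstEntryTerm n a 0) +_) (firstEntryTerm-top n a 0 a≤1+n) ⟩
  sumTo n (firstEntryTerm n a 0) + I * H≥ (suc n) a 0       ≡⟨ cong (_+ I * H≥ (suc n) a 0) (H≥-firstEntry n a 0) ⟨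
  H≥ n a 1 + I * H≥ (suc n) a 0                       ∎
  where
  open ≡-Reasoning
  I = inv (suc n)
H≥-extendRange n (suc m) a a≤1+n = begin
  H≥ (suc n) a (suc (suc m))
    ≡⟨ H≥-firstEntry (suc n) a (suc m) ⟩
  sumTo n (firstEntryTerm (suc n) a (suc m)) + firstEntryTerm (suc n) a (suc m) (suc n)
    ≡⟨ cong₂ _+_ (sumTo-cong n firstEntryTerm-split) (firstEntryTerm-top n a (suc m) a≤1+n) ⟩
  sumTo n (λ b → firstEntryTerm n a (suc m) b + I * firstEntryTerm (suc n) a m b) + I * H≥ (suc n) (suc n) (suc m)
    ≡⟨ cong₂ _+_ (trans (sumTo-+ n _ _) (cong (X +_) (sumTo-*ˡ n I _))) (cong (I *_) (H≥-top n m)) ⟩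
  (X + I * Y) + I * (I * Z)
    ≡⟨ regroup X Y Z I ⟩
  X + I * (Y + I * Z)
    ≡⟨ cong₂ (λ u v → u + I * v) (H≥-firstEntry n a (suc m))
             (trans (H≥-firstEntry (suc n) a m) (cong (Y +_) (firstEntryTerm-top n a m a≤1+n))) ⟨
  H≥ n a (suc (suc m)) + I * H≥ (suc n) a (suc m) ∎
  where
  open ≡-Reasoning
  I = inv (suc n)
  X = sumTo n (firstEntryTerm n a (suc m))
  Y = sumTo n (firstEntryTerm (suc n) a m)
  Z = H≥ (suc n) (suc n) m
  regroup : ∀ X Y Z I → (X + I * Y) + I * (I * Z) ≡ X + I * (Y + I * Z)
  regroup = solve-∀ ℚ-ring
  distrib : ∀ u x y i → u * (x + i * y) ≡ u * x + i * (u * y)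
  distrib = solve-∀ ℚ-ring
  firstEntryTerm-split : ∀ b → b ≤ n → firstEntryTerm (suc n) a (suc m) b ≡ firstEntryTerm n a (suc m) b + I * firstEntryTerm (suc n) a m b
  firstEntryTerm-split b b≤n with a ≤ᵇ b
  ... | true  = trans (cong (inv b *_) (H≥-extendRange n m b (ℕ.m≤n⇒m≤1+n b≤n))) (distrib (inv b) _ _ I)
  ... | false = sym (trans (+-identityˡ _) (*-zeroʳ I))

H-rec : ∀ n m → H (suc n) (suc m) ≡ H n (suc m) + inv (suc n) * H (suc n) m
H-rec n m = begin
  H (suc n) (suc m)                            ≡⟨ H≡H≥0 (suc n) (suc m) ⟩
  H≥ (suc n) 0 (suc m)                         ≡⟨ H≥-extendRange n m 0 ℕ.z≤n ⟩
  H≥ n 0 (suc m) + inv (suc n) * H≥ (suc n) 0 m ≡⟨ cong₂ (λ u v → u + inv (suc n) * v) (H≡H≥0 n (suc m)) (H≡H≥0 (suc n) m) ⟨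
  H n (suc m) + inv (suc n) * H (suc n) m      ∎
  where open ≡-Reasoning

-- Binomial coefficients

pascal : ∀ n k → suc n C suc k ≡ n C k ℕ.+ n C suc k
pascal n k = sym (nCk+nC[k+1]≡[n+1]C[k+1] n k)

absorption : ∀ n r → suc r ℕ.* (suc n C suc r) ≡ suc n ℕ.* (n C r)
absorption zero    zero    = refl
absorption zero    (suc r) = ℕ.*-zeroʳ (suc (suc r))
absorption (suc n) r       = begin
  suc r ℕ.* (suc (suc n) C suc r)                       ≡⟨ cong (suc r ℕ.*_) (pascal (suc n) r) ⟩
  suc r ℕ.* (suc n C r ℕ.+ suc n C suc r)               ≡⟨ ℕ.*-distribˡ-+ (suc r) (suc n C r) _ ⟩
  suc r ℕ.* (suc n C r) ℕ.+ suc r ℕ.* (suc n C suc r)   ≡⟨ cong (suc r ℕ.* (suc n C r) ℕ.+_) (absorption n r) ⟩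
  suc r ℕ.* (suc n C r) ℕ.+ suc n ℕ.* (n C r)           ≡⟨ lowerRow r ⟩
  suc (suc n) ℕ.* (suc n C r)                           ∎
  where
  open ≡-Reasoning
  lowerRow : ∀ r → suc r ℕ.* (suc n C r) ℕ.+ suc n ℕ.* (n C r) ≡ suc (suc n) ℕ.* (suc n C r)
  lowerRow zero     = ℕ-Solver.solve-∀
  lowerRow (suc r) = begin
    suc (suc r) ℕ.* (suc n C suc r) ℕ.+ suc n ℕ.* (n C suc r)
      ≡⟨ cong (λ z → (suc n C suc r) ℕ.+ z ℕ.+ suc n ℕ.* (n C suc r)) (absorption n r) ⟩
    (suc n C suc r) ℕ.+ suc n ℕ.* (n C r) ℕ.+ suc n ℕ.* (n C suc r)
      ≡⟨ factor (suc n C suc r) (suc n) (n C r) (n C suc r) ⟩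
    (suc n C suc r) ℕ.+ suc n ℕ.* (n C r ℕ.+ n C suc r)
      ≡⟨ cong (λ z → (suc n C suc r) ℕ.+ suc n ℕ.* z) (pascal n r) ⟨
    suc (suc n) ℕ.* (suc n C suc r) ∎
    where
    factor : ∀ x s a b → x ℕ.+ s ℕ.* a ℕ.+ s ℕ.* b ≡ x ℕ.+ s ℕ.* (a ℕ.+ b)
    factor = ℕ-Solver.solve-∀

absorption-derivative : ∀ n r → suc r ℕ.* (n C suc r) ℕ.+ r ℕ.* (n C r) ≡ n ℕ.* (n C r)
absorption-derivative zero    zero    = refl
absorption-derivative zero    (suc r) = cong₂ ℕ._+_ (ℕ.*-zeroʳ (suc (suc r))) (ℕ.*-zeroʳ (suc r))
absorption-derivative (suc n) zero    = trans (ℕ.+-identityʳ _) (trans (ℕ.*-identityˡ _) (trans (nC1≡n (suc n)) (sym (ℕ.*-identityʳ (suc n)))))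
absorption-derivative (suc n) (suc r) = begin
  suc (suc r) ℕ.* (suc n C suc (suc r)) ℕ.+ suc r ℕ.* (suc n C suc r) ≡⟨ cong₂ ℕ._+_ (absorption n (suc r)) (absorption n r) ⟩
  suc n ℕ.* (n C suc r) ℕ.+ suc n ℕ.* (n C r)                        ≡⟨ ℕ.*-distribˡ-+ (suc n) (n C suc r) (n C r) ⟨
  suc n ℕ.* (n C suc r ℕ.+ n C r)                                    ≡⟨ cong (suc n ℕ.*_) (ℕ.+-comm (n C suc r) (n C r)) ⟩
  suc n ℕ.* (n C r ℕ.+ n C suc r)                                    ≡⟨ cong (suc n ℕ.*_) (pascal n r) ⟨
  suc n ℕ.* (suc n C suc r)                                          ∎
  where open ≡-Reasoning

pascalℚ : ∀ n k → ℕ→ℚ (suc n C suc k) ≡ ℕ→ℚ (n C k) + ℕ→ℚ (n C suc k)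
pascalℚ n k = trans (cong ℕ→ℚ (pascal n k)) (ℕ→ℚ-homo-+ (n C k) (n C suc k))

absorptionℚ : ∀ n r → ℕ→ℚ (suc r) * ℕ→ℚ (suc n C suc r) ≡ ℕ→ℚ (suc n) * ℕ→ℚ (n C r)
absorptionℚ n r = trans (sym (ℕ→ℚ-homo-* (suc r) (suc n C suc r)))
                        (trans (cong ℕ→ℚ (absorption n r)) (ℕ→ℚ-homo-* (suc n) (n C r)))

absorption-derivativeℚ : ∀ n r → ℕ→ℚ (suc r) * ℕ→ℚ (n C suc r) + ℕ→ℚ r * ℕ→ℚ (n C r) ≡ ℕ→ℚ n * ℕ→ℚ (n C r)
absorption-derivativeℚ n r = begin
  ℕ→ℚ (suc r) * ℕ→ℚ (n C suc r) + ℕ→ℚ r * ℕ→ℚ (n C r)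
    ≡⟨ cong₂ _+_ (ℕ→ℚ-homo-* (suc r) (n C suc r)) (ℕ→ℚ-homo-* r (n C r)) ⟨
  ℕ→ℚ (suc r ℕ.* (n C suc r)) + ℕ→ℚ (r ℕ.* (n C r))
    ≡⟨ ℕ→ℚ-homo-+ (suc r ℕ.* (n C suc r)) (r ℕ.* (n C r)) ⟨
  ℕ→ℚ (suc r ℕ.* (n C suc r) ℕ.+ r ℕ.* (n C r))
    ≡⟨ cong ℕ→ℚ (absorption-derivative n r) ⟩
  ℕ→ℚ (n ℕ.* (n C r))
    ≡⟨ ℕ→ℚ-homo-* n (n C r) ⟩
  ℕ→ℚ n * ℕ→ℚ (n C r) ∎
  where open ≡-Reasoning

absorption/! : ∀ n r → ℕ→ℚ (suc r) * (inv (suc n !) * ℕ→ℚ (suc n C suc r)) ≡ inv (n !) * ℕ→ℚ (n C r)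
absorption/! n r = begin
  ℕ→ℚ (suc r) * (inv (suc n !) * ℕ→ℚ (suc n C suc r)) ≡⟨ swap (ℕ→ℚ (suc r)) (inv (suc n !)) (ℕ→ℚ (suc n C suc r)) ⟩
  inv (suc n !) * (ℕ→ℚ (suc r) * ℕ→ℚ (suc n C suc r)) ≡⟨ cong (inv (suc n !) *_) (absorptionℚ n r) ⟩
  inv (suc n !) * (ℕ→ℚ (suc n) * ℕ→ℚ (n C r))         ≡⟨ swap (inv (suc n !)) (ℕ→ℚ (suc n)) (ℕ→ℚ (n C r)) ⟩
  ℕ→ℚ (suc n) * (inv (suc n !) * ℕ→ℚ (n C r))         ≡⟨ *-assoc (ℕ→ℚ (suc n)) (inv (suc n !)) (ℕ→ℚ (n C r)) ⟨
  (ℕ→ℚ (suc n) * inv (suc n !)) * ℕ→ℚ (n C r)         ≡⟨ cong (_* ℕ→ℚ (n C r)) (ℕ→ℚ*inv-suc! n) ⟩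
  inv (n !) * ℕ→ℚ (n C r)                              ∎
  where
  open ≡-Reasoning
  swap : ∀ a b c → a * (b * c) ≡ b * (a * c)
  swap = solve-∀ ℚ-ring

D1x-binomial : ∀ n (b : ℕ → ℚ) r k →
               D1x (λ r k → ℕ→ℚ (n C r) * b k) r k ≡ ℕ→ℚ (n C r) * (ℕ→ℚ n * b k + ℕ→ℚ (suc k) * b (suc k))
D1x-binomial n b r k = begin
  ℕ→ℚ (suc r) * (ℕ→ℚ (n C suc r) * b k) + ℕ→ℚ r * (ℕ→ℚ (n C r) * b k) + ℕ→ℚ (suc k) * (ℕ→ℚ (n C r) * b (suc k))
    ≡⟨ collect (ℕ→ℚ (suc r)) (ℕ→ℚ (n C suc r)) (ℕ→ℚ r) (ℕ→ℚ (n C r)) (ℕ→ℚ (suc k)) (b k) (b (suc k)) ⟩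
  (ℕ→ℚ (suc r) * ℕ→ℚ (n C suc r) + ℕ→ℚ r * ℕ→ℚ (n C r)) * b k + ℕ→ℚ (n C r) * (ℕ→ℚ (suc k) * b (suc k))
    ≡⟨ cong (λ z → z * b k + ℕ→ℚ (n C r) * (ℕ→ℚ (suc k) * b (suc k))) (absorption-derivativeℚ n r) ⟩
  (ℕ→ℚ n * ℕ→ℚ (n C r)) * b k + ℕ→ℚ (n C r) * (ℕ→ℚ (suc k) * b (suc k))
    ≡⟨ factor (ℕ→ℚ n) (ℕ→ℚ (n C r)) (b k) (ℕ→ℚ (suc k) * b (suc k)) ⟩
  ℕ→ℚ (n C r) * (ℕ→ℚ n * b k + ℕ→ℚ (suc k) * b (suc k)) ∎
  where
  open ≡-Reasoning
  collect : ∀ a c a′ c′ e x y → a * (c * x) + a′ * (c′ * x) + e * (c′ * y) ≡ (a * c + a′ * c′) * x + c′ * (e * y)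
  collect = solve-∀ ℚ-ring
  factor : ∀ m c x z → (m * c) * x + c * z ≡ c * (m * x + z)
  factor = solve-∀ ℚ-ring

mul1x-binomial : ∀ n c k b → (∀ r → c r k ≡ ℕ→ℚ (n C r) * b) → ∀ r → mul1x c r k ≡ ℕ→ℚ (suc n C r) * b
mul1x-binomial n c k b column zero    = column zero
mul1x-binomial n c k b column (suc r) = begin
  c (suc r) k + c r k                ≡⟨ cong₂ _+_ (column (suc r)) (column r) ⟩
  ℕ→ℚ (n C suc r) * b + ℕ→ℚ (n C r) * b ≡⟨ *-distribʳ-+ b (ℕ→ℚ (n C suc r)) (ℕ→ℚ (n C r)) ⟨
  (ℕ→ℚ (n C suc r) + ℕ→ℚ (n C r)) * b   ≡⟨ cong (_* b) (+-comm (ℕ→ℚ (n C suc r)) (ℕ→ℚ (n C r))) ⟩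
  (ℕ→ℚ (n C r) + ℕ→ℚ (n C suc r)) * b   ≡⟨ cong (_* b) (pascalℚ n r) ⟨
  ℕ→ℚ (suc n C suc r) * b              ∎
  where open ≡-Reasoning

-- Uniqueness of the integral family

downwardInduction : ∀ (P : ℕ → Set) N → (∀ i → N ≤ i → P i) → (∀ i → P (suc i) → P i) → ∀ i → P i
downwardInduction P N base step i = within N i (ℕ.m≤n+m N i)
  where
  within : ∀ d i → N ≤ i ℕ.+ d → P i
  within zero    i N≤i   = base i (subst (N ≤_) (ℕ.+-identityʳ i) N≤i)
  within (suc d) i N≤i+d = step i (within d (suc i) (subst (N ≤_) (ℕ.+-suc i d) N≤i+d))

x-y≡0⇒x≡y : ∀ x y → x - y ≡ 0ℚ → x ≡ y
x-y≡0⇒x≡y x y x-y≡0 = trans (split x y) (trans (cong (_+ y) x-y≡0) (+-identityˡ y))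
  where
  split : ∀ x y → x ≡ (x - y) + y
  split = solve-∀ ℚ-ring

-- In D1x c (1 + r) k the coefficient c (1 + r) k has the nonzero factor 1 + r and the other two
-- coefficients lie further out, so the rows r ≥ 1 vanish from the boundary of the support inwards.
D1x≡0⇒positiveRows≡0 : ∀ c → FiniteSupport c → (∀ r k → D1x c r k ≡ 0ℚ) → ∀ k r → c (suc r) k ≡ 0ℚ
D1x≡0⇒positiveRows≡0 c (N , outside) D1x≡0 =
  downwardInduction (λ k → ∀ r → c (suc r) k ≡ 0ℚ) N
    (λ k N≤k r → outside (suc r) k (inj₂ N≤k))
    (λ k column → downwardInduction (λ r → c (suc r) k ≡ 0ℚ) N
                    (λ r N≤r → outside (suc r) k (inj₁ (ℕ.m≤n⇒m≤1+n N≤r)))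
                    (rowStep k column))
  where
  open ≡-Reasoning
  middle : ∀ a b d x → a * 0ℚ + b * x + d * 0ℚ ≡ b * x
  middle = solve-∀ ℚ-ring
  rowStep : ∀ k → (∀ r → c (suc r) (suc k) ≡ 0ℚ) → ∀ r → c (suc (suc r)) k ≡ 0ℚ → c (suc r) k ≡ 0ℚ
  rowStep k column r below = ℕ→ℚ*x≡0⇒x≡0 (suc r) (c (suc r) k) (begin
    ℕ→ℚ (suc r) * c (suc r) k
      ≡⟨ middle (ℕ→ℚ (suc (suc r))) (ℕ→ℚ (suc r)) (ℕ→ℚ (suc k)) (c (suc r) k) ⟨
    ℕ→ℚ (suc (suc r)) * 0ℚ + ℕ→ℚ (suc r) * c (suc r) k + ℕ→ℚ (suc k) * 0ℚ
      ≡⟨ cong₂ (λ u v → ℕ→ℚ (suc (suc r)) * u + ℕ→ℚ (suc r) * c (suc r) k + ℕ→ℚ (suc k) * v) below (column r) ⟨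
    D1x c (suc r) k
      ≡⟨ D1x≡0 (suc r) k ⟩
    0ℚ ∎)

D1x≡0⇒≡0 : ∀ c → FiniteSupport c → (∀ r k → D1x c r k ≡ 0ℚ) → at0 c ≡ 0ℚ → ∀ r k → c r k ≡ 0ℚ
D1x≡0⇒≡0 c finite D1x≡0 c00≡0 (suc r) k       = D1x≡0⇒positiveRows≡0 c finite D1x≡0 k r
D1x≡0⇒≡0 c finite D1x≡0 c00≡0 zero    zero    = c00≡0
D1x≡0⇒≡0 c finite D1x≡0 c00≡0 zero    (suc k) = ℕ→ℚ*x≡0⇒x≡0 (suc k) (c 0 (suc k)) (begin
  ℕ→ℚ (suc k) * c 0 (suc k)
    ≡⟨ last (c 0 k) (ℕ→ℚ (suc k) * c 0 (suc k)) ⟨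
  1ℚ * 0ℚ + 0ℚ * c 0 k + ℕ→ℚ (suc k) * c 0 (suc k)
    ≡⟨ cong (λ u → 1ℚ * u + 0ℚ * c 0 k + ℕ→ℚ (suc k) * c 0 (suc k)) (D1x≡0⇒positiveRows≡0 c finite D1x≡0 k 0) ⟨
  D1x c 0 k
    ≡⟨ D1x≡0 0 k ⟩
  0ℚ ∎)
  where
  open ≡-Reasoning
  last : ∀ x y → 1ℚ * 0ℚ + 0ℚ * x + y ≡ y
  last = solve-∀ ℚ-ring

FiniteSupport-− : ∀ {c d} → FiniteSupport c → FiniteSupport d → FiniteSupport (λ r k → c r k - d r k)
FiniteSupport-− {c} {d} (M , c≡0) (N , d≡0) = M ℕ.+ N , outside
  where
  outside : ∀ r k → M ℕ.+ N ≤ r ⊎ M ℕ.+ N ≤ k → c r k - d r k ≡ 0ℚ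
  outside r k (inj₁ M+N≤r) = cong₂ _-_ (c≡0 r k (inj₁ (ℕ.m+n≤o⇒m≤o M M+N≤r))) (d≡0 r k (inj₁ (ℕ.m+n≤o⇒n≤o M M+N≤r)))
  outside r k (inj₂ M+N≤k) = cong₂ _-_ (c≡0 r k (inj₂ (ℕ.m+n≤o⇒m≤o M M+N≤k))) (d≡0 r k (inj₂ (ℕ.m+n≤o⇒n≤o M M+N≤k)))

D1x-− : ∀ c d r k → D1x (λ r k → c r k - d r k) r k ≡ D1x c r k - D1x d r k
D1x-− c d r k = linear (ℕ→ℚ (suc r)) (ℕ→ℚ r) (ℕ→ℚ (suc k))
                       (c (suc r) k) (d (suc r) k) (c r k) (d r k) (c r (suc k)) (d r (suc k))
  where
  linear : ∀ a b e x₁ y₁ x₂ y₂ x₃ y₃ →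
           a * (x₁ - y₁) + b * (x₂ - y₂) + e * (x₃ - y₃) ≡ (a * x₁ + b * x₂ + e * x₃) - (a * y₁ + b * y₂ + e * y₃)
  linear = solve-∀ ℚ-ring

mul1x-cong : ∀ {c d} → (∀ r k → c r k ≡ d r k) → ∀ r k → mul1x c r k ≡ mul1x d r k
mul1x-cong c≗d zero    k = c≗d zero k
mul1x-cong c≗d (suc r) k = cong₂ _+_ (c≗d (suc r) k) (c≗d r k)

integralFamily-unique : ∀ {j F G} → IsIntegralFamily j F → IsIntegralFamily j G → ∀ n r k → F n r k ≡ G n r k
integralFamily-unique (_ , F₀ , _) (_ , G₀ , _) zero r k = trans (F₀ r k) (sym (G₀ r k))
integralFamily-unique {F = F} {G} isF@(finF , _ , F′ , F[0]) isG@(finG , _ , G′ , G[0]) (suc n) r k =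
  x-y≡0⇒x≡y _ _ (D1x≡0⇒≡0 difference (FiniteSupport-− (finF (suc n)) (finG (suc n))) D1x≡0 at0≡0 r k)
  where
  difference : Expr
  difference r k = F (suc n) r k - G (suc n) r k
  D1x≡0 : ∀ r k → D1x difference r k ≡ 0ℚ
  D1x≡0 r k = begin
    D1x difference r k                         ≡⟨ D1x-− (F (suc n)) (G (suc n)) r k ⟩
    D1x (F (suc n)) r k - D1x (G (suc n)) r k ≡⟨ cong₂ _-_ (F′ n r k) (G′ n r k) ⟩
    mul1x (F n) r k - mul1x (G n) r k          ≡⟨ cong (λ y → mul1x (F n) r k - y) (mul1x-cong (integralFamily-unique isF isG n) r k) ⟨
    mul1x (F n) r k - mul1x (F n) r k          ≡⟨ +-inverseʳ (mul1x (F n) r k) ⟩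
    0ℚ                                         ∎
    where open ≡-Reasoning
  at0≡0 : at0 difference ≡ 0ℚ
  at0≡0 = cong₂ _-_ (F[0] n) (G[0] n)

-- The closed form

Ĥ : ℕ → ℕ → ℚ
Ĥ n m = inv (n !) * H n m

Ĥ-rec : ∀ n m → ℕ→ℚ (suc n) * Ĥ (suc n) (suc m) ≡ Ĥ n (suc m) + Ĥ (suc n) m
Ĥ-rec n m = begin
  ℕ→ℚ (suc n) * (inv (suc n !) * H (suc n) (suc m))
    ≡⟨ *-assoc (ℕ→ℚ (suc n)) (inv (suc n !)) (H (suc n) (suc m)) ⟨
  (ℕ→ℚ (suc n) * inv (suc n !)) * H (suc n) (suc m)
    ≡⟨ cong₂ _*_ (ℕ→ℚ*inv-suc! n) (H-rec n m) ⟩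
  inv (n !) * (H n (suc m) + inv (suc n) * H (suc n) m)
    ≡⟨ distrib (inv (n !)) (H n (suc m)) (inv (suc n)) (H (suc n) m) ⟩
  Ĥ n (suc m) + (inv (suc n) * inv (n !)) * H (suc n) m
    ≡⟨ cong (λ c → Ĥ n (suc m) + c * H (suc n) m) (inv-suc! n) ⟨
  Ĥ n (suc m) + Ĥ (suc n) m ∎
  where
  open ≡-Reasoning
  distrib : ∀ a x i y → a * (x + i * y) ≡ a * x + (i * a) * y
  distrib = solve-∀ ℚ-ring

Ĥ-rec-0 : ∀ n → ℕ→ℚ (suc n) * Ĥ (suc n) 0 ≡ Ĥ n 0
Ĥ-rec-0 n = trans (sym (*-assoc (ℕ→ℚ (suc n)) (inv (suc n !)) 1ℚ)) (cong (_* 1ℚ) (ℕ→ℚ*inv-suc! n))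

m∸n≡1+[m∸1+n] : ∀ {m n} → n < m → m ∸ n ≡ suc (m ∸ suc n)
m∸n≡1+[m∸1+n] {suc m} {zero}  _           = refl
m∸n≡1+[m∸1+n] {suc m} {suc n} (ℕ.s≤s n<m) = m∸n≡1+[m∸1+n] n<m

logCoeff : ℕ → ℕ → ℕ → ℚ
logCoeff j n k = if k ℕ.≤ᵇ j then sgn (j ∸ k) * ℕ→ℚ (j !) * inv (k !) * Ĥ n (j ∸ k) else 0ℚ

-- closedForm j n encodes f_{n,j} = A_{n,j}(x) + Σ_k logCoeff j n k · (1+x)^n ln^k(1+x):
-- the binomial coefficients in the columns k ≥ 1 are those of (1+x)^n.
closedForm : ℕ → ℕ → Expr
closedForm j n r zero    = Acoeff n j r
closedForm j n r (suc k) = ℕ→ℚ (n C r) * logCoeff j n (suc k)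

logCoeff-≤ : ∀ {j k} n → k ≤ j → logCoeff j n k ≡ sgn (j ∸ k) * ℕ→ℚ (j !) * inv (k !) * Ĥ n (j ∸ k)
logCoeff-≤ n = if-≤ᵇ-yes

logCoeff-> : ∀ {j k} n → j < k → logCoeff j n k ≡ 0ℚ
logCoeff-> n = if-≤ᵇ-no

logCoeff-< : ∀ {j k} n → k < j →
             logCoeff j n k ≡ - sgn (j ∸ suc k) * ℕ→ℚ (j !) * inv (k !) * Ĥ n (suc (j ∸ suc k))
logCoeff-< {j} {k} n k<j =
  trans (logCoeff-≤ n (ℕ.<⇒≤ k<j)) (cong (λ d → sgn d * ℕ→ℚ (j !) * inv (k !) * Ĥ n d) (m∸n≡1+[m∸1+n] k<j))

logCoeff-diag : ∀ j n → logCoeff j n j ≡ Ĥ n 0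
logCoeff-diag j n = begin
  logCoeff j n j                                        ≡⟨ logCoeff-≤ {j} n ℕ.≤-refl ⟩
  sgn (j ∸ j) * ℕ→ℚ (j !) * inv (j !) * Ĥ n (j ∸ j)   ≡⟨ cong (λ d → sgn d * ℕ→ℚ (j !) * inv (j !) * Ĥ n d) (ℕ.n∸n≡0 j) ⟩
  1ℚ * ℕ→ℚ (j !) * inv (j !) * Ĥ n 0                  ≡⟨ cong (λ u → u * inv (j !) * Ĥ n 0) (*-identityˡ (ℕ→ℚ (j !))) ⟩
  ℕ→ℚ (j !) * inv (j !) * Ĥ n 0                       ≡⟨ cong (_* Ĥ n 0) (ℕ→ℚ*inv≡1 (j !) {{j ℕ.!≢0}}) ⟩
  1ℚ * Ĥ n 0                                            ≡⟨ *-identityˡ (Ĥ n 0) ⟩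
  Ĥ n 0                                                 ∎
  where open ≡-Reasoning

logCoeff-rec-< : ∀ {j k} n → suc k < j →
                 ℕ→ℚ (suc n) * logCoeff j (suc n) (suc k) + ℕ→ℚ (suc (suc k)) * logCoeff j (suc n) (suc (suc k))
                 ≡ logCoeff j n (suc k)
logCoeff-rec-< {j} {k} n 1+k<j = begin
  ℕ→ℚ (suc n) * logCoeff j (suc n) (suc k) + ℕ→ℚ (suc (suc k)) * logCoeff j (suc n) (suc (suc k))
    ≡⟨ cong₂ (λ u v → ℕ→ℚ (suc n) * u + ℕ→ℚ (suc (suc k)) * v) (logCoeff-< (suc n) 1+k<j) (logCoeff-≤ (suc n) 1+k<j) ⟩
  ℕ→ℚ (suc n) * (- σ * J * φ * Ĥ (suc n) (suc m)) + ℕ→ℚ (suc (suc k)) * (σ * J * inv (suc (suc k) !) * Ĥ (suc n) m)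
    ≡⟨ regroup (ℕ→ℚ (suc n)) (ℕ→ℚ (suc (suc k))) σ J φ (inv (suc (suc k) !)) (Ĥ (suc n) (suc m)) (Ĥ (suc n) m) ⟩
  - σ * J * φ * (ℕ→ℚ (suc n) * Ĥ (suc n) (suc m)) + σ * J * (ℕ→ℚ (suc (suc k)) * inv (suc (suc k) !)) * Ĥ (suc n) m
    ≡⟨ cong₂ (λ u v → - σ * J * φ * u + σ * J * v * Ĥ (suc n) m) (Ĥ-rec n m) (ℕ→ℚ*inv-suc! (suc k)) ⟩
  - σ * J * φ * (Ĥ n (suc m) + Ĥ (suc n) m) + σ * J * φ * Ĥ (suc n) m
    ≡⟨ cancel σ J φ (Ĥ n (suc m)) (Ĥ (suc n) m) ⟩
  - σ * J * φ * Ĥ n (suc m)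
    ≡⟨ logCoeff-< n 1+k<j ⟨
  logCoeff j n (suc k) ∎
  where
  open ≡-Reasoning
  m = j ∸ suc (suc k)
  σ = sgn m
  J = ℕ→ℚ (j !)
  φ = inv (suc k !)
  regroup : ∀ a b σ J φ ψ x y → a * (- σ * J * φ * x) + b * (σ * J * ψ * y) ≡ - σ * J * φ * (a * x) + σ * J * (b * ψ) * y
  regroup = solve-∀ ℚ-ring
  cancel : ∀ σ J φ x y → - σ * J * φ * (x + y) + σ * J * φ * y ≡ - σ * J * φ * x
  cancel = solve-∀ ℚ-ring

logCoeff-rec : ∀ j n k → ℕ→ℚ (suc n) * logCoeff j (suc n) (suc k) + ℕ→ℚ (suc (suc k)) * logCoeff j (suc n) (suc (suc k))
                         ≡ logCoeff j n (suc k)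
logCoeff-rec j n k with ℕ.<-cmp (suc k) j
... | tri> _ _ j<1+k = begin
  ℕ→ℚ (suc n) * logCoeff j (suc n) (suc k) + ℕ→ℚ (suc (suc k)) * logCoeff j (suc n) (suc (suc k))
    ≡⟨ cong₂ (λ u v → ℕ→ℚ (suc n) * u + ℕ→ℚ (suc (suc k)) * v) (logCoeff-> (suc n) j<1+k) (logCoeff-> (suc n) (ℕ.m<n⇒m<1+n j<1+k)) ⟩
  ℕ→ℚ (suc n) * 0ℚ + ℕ→ℚ (suc (suc k)) * 0ℚ
    ≡⟨ cong₂ _+_ (*-zeroʳ (ℕ→ℚ (suc n))) (*-zeroʳ (ℕ→ℚ (suc (suc k)))) ⟩
  0ℚ
    ≡⟨ logCoeff-> n j<1+k ⟨
  logCoeff j n (suc k) ∎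
  where open ≡-Reasoning
... | tri≈ _ refl _ = begin
  ℕ→ℚ (suc n) * logCoeff j (suc n) j + ℕ→ℚ (suc j) * logCoeff j (suc n) (suc j)
    ≡⟨ cong₂ (λ u v → ℕ→ℚ (suc n) * u + ℕ→ℚ (suc j) * v) (logCoeff-diag j (suc n)) (logCoeff-> {j} (suc n) ℕ.≤-refl) ⟩
  ℕ→ℚ (suc n) * Ĥ (suc n) 0 + ℕ→ℚ (suc j) * 0ℚ
    ≡⟨ cong (ℕ→ℚ (suc n) * Ĥ (suc n) 0 +_) (*-zeroʳ (ℕ→ℚ (suc j))) ⟩
  ℕ→ℚ (suc n) * Ĥ (suc n) 0 + 0ℚ
    ≡⟨ +-identityʳ _ ⟩
  ℕ→ℚ (suc n) * Ĥ (suc n) 0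
    ≡⟨ Ĥ-rec-0 n ⟩
  Ĥ n 0
    ≡⟨ logCoeff-diag j n ⟨
  logCoeff j n j ∎
  where open ≡-Reasoning
... | tri< 1+k<j _ _ = logCoeff-rec-< n 1+k<j

harmonicTail : ℕ → ℕ → ℕ → ℚ
harmonicTail j n r = sumBelow r (λ i → H (n ∸ i) (j ∸ 1) * inv (n ∸ i))

Acoeff≡ : ∀ n j r → Acoeff n j r ≡ sgn j * ℕ→ℚ (j !) * inv (n !) * ℕ→ℚ (n C r) * harmonicTail j n r
Acoeff≡ n j zero    = sym (*-zeroʳ (sgn j * ℕ→ℚ (j !) * inv (n !) * ℕ→ℚ (n C 0)))
Acoeff≡ n j (suc r) with ℕ.≤-<-connex (suc r) n
... | inj₁ 1+r≤n = trans (if-≤ᵇ-yes 1+r≤n)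
                         (cong (c * ℕ→ℚ (n C suc r) *_) (sumOver-applyUpTo (λ i → H (n ∸ i) (j ∸ 1) * inv (n ∸ i)) (λ i → i) (suc r)))
  where c = sgn j * ℕ→ℚ (j !) * inv (n !)
... | inj₂ n<1+r = trans (if-≤ᵇ-no n<1+r) (sym (begin
  c * ℕ→ℚ (n C suc r) * harmonicTail j n (suc r) ≡⟨ cong (λ b → c * ℕ→ℚ b * harmonicTail j n (suc r)) (k>n⇒nCk≡0 n<1+r) ⟩
  c * 0ℚ * harmonicTail j n (suc r)              ≡⟨ cong (_* harmonicTail j n (suc r)) (*-zeroʳ c) ⟩
  0ℚ * harmonicTail j n (suc r)                  ≡⟨ *-zeroˡ (harmonicTail j n (suc r)) ⟩
  0ℚ                                              ∎))
  where
  open ≡-Reasoning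
  c = sgn j * ℕ→ℚ (j !) * inv (n !)

logCoeff-1 : ∀ j n → logCoeff (suc j) (suc n) 1 ≡ sgn j * ℕ→ℚ (suc j !) * (inv (n !) * (H (suc n) j * inv (suc n)))
logCoeff-1 j n = begin
  logCoeff (suc j) (suc n) 1                               ≡⟨ logCoeff-≤ {suc j} (suc n) (ℕ.s≤s ℕ.z≤n) ⟩
  σ * J * 1ℚ * (inv (suc n !) * H (suc n) j)               ≡⟨ cong (λ i → σ * J * 1ℚ * (i * H (suc n) j)) (inv-suc! n) ⟩
  σ * J * 1ℚ * ((inv (suc n) * inv (n !)) * H (suc n) j)   ≡⟨ regroup σ J (inv (suc n)) (inv (n !)) (H (suc n) j) ⟩
  σ * J * (inv (n !) * (H (suc n) j * inv (suc n)))        ∎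
  where
  open ≡-Reasoning
  σ = sgn j
  J = ℕ→ℚ (suc j !)
  regroup : ∀ σ J i ι h → σ * J * 1ℚ * ((i * ι) * h) ≡ σ * J * (ι * (h * i))
  regroup = solve-∀ ℚ-ring

closedForm-D1x-log : ∀ j n r k → D1x (closedForm j (suc n)) r (suc k) ≡ mul1x (closedForm j n) r (suc k)
closedForm-D1x-log j n r k = begin
  D1x (closedForm j (suc n)) r (suc k)
    ≡⟨ D1x-binomial (suc n) (logCoeff j (suc n)) r (suc k) ⟩
  ℕ→ℚ (suc n C r) * (ℕ→ℚ (suc n) * logCoeff j (suc n) (suc k) + ℕ→ℚ (suc (suc k)) * logCoeff j (suc n) (suc (suc k)))
    ≡⟨ cong (ℕ→ℚ (suc n C r) *_) (logCoeff-rec j n k) ⟩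
  ℕ→ℚ (suc n C r) * logCoeff j n (suc k)
    ≡⟨ mul1x-binomial n (closedForm j n) (suc k) (logCoeff j n (suc k)) (λ _ → refl) r ⟨
  mul1x (closedForm j n) r (suc k) ∎
  where open ≡-Reasoning

module _ (j n : ℕ) where

  private
    σ = sgn j
    J = ℕ→ℚ (suc j !)
    I = inv (n !)
    I′ = inv (suc n !)
    h = H (suc n) j * inv (suc n)

  closedForm-D1x-constant : D1x (closedForm (suc j) (suc n)) 0 0 ≡ mul1x (closedForm (suc j) n) 0 0
  closedForm-D1x-constant = begin
    1ℚ * Acoeff (suc n) (suc j) 1 + 0ℚ * 0ℚ + 1ℚ * (1ℚ * logCoeff (suc j) (suc n) 1)
      ≡⟨ cong₂ (λ a b → 1ℚ * a + 0ℚ * 0ℚ + 1ℚ * (1ℚ * b)) (Acoeff≡ (suc n) (suc j) 1) (logCoeff-1 j n) ⟩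
    1ℚ * (- σ * J * I′ * ℕ→ℚ (suc n C 1) * (h + 0ℚ)) + 0ℚ * 0ℚ + 1ℚ * (1ℚ * (σ * J * (I * h)))
      ≡⟨ regroup σ J I′ (ℕ→ℚ (suc n C 1)) I h ⟩
    - σ * J * (1ℚ * (I′ * ℕ→ℚ (suc n C 1))) * h + σ * J * I * h
      ≡⟨ cong (λ u → - σ * J * u * h + σ * J * I * h) (absorption/! n 0) ⟩
    - σ * J * (I * 1ℚ) * h + σ * J * I * h
      ≡⟨ cancel σ J I h ⟩
    0ℚ ∎
    where
    open ≡-Reasoning
    regroup : ∀ σ J I′ c I h → 1ℚ * (- σ * J * I′ * c * (h + 0ℚ)) + 0ℚ * 0ℚ + 1ℚ * (1ℚ * (σ * J * (I * h)))
                               ≡ - σ * J * (1ℚ * (I′ * c)) * h + σ * J * I * h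
    regroup = solve-∀ ℚ-ring
    cancel : ∀ σ J I h → - σ * J * (I * 1ℚ) * h + σ * J * I * h ≡ 0ℚ
    cancel = solve-∀ ℚ-ring

  closedForm-D1x-poly : ∀ r → D1x (closedForm (suc j) (suc n)) (suc r) 0 ≡ mul1x (closedForm (suc j) n) (suc r) 0
  closedForm-D1x-poly r = begin
    a₂ * Acoeff (suc n) (suc j) (suc (suc r)) + a₁ * Acoeff (suc n) (suc j) (suc r) + 1ℚ * (c₁ * logCoeff (suc j) (suc n) 1)
      ≡⟨ cong₃ (λ x y z → a₂ * x + a₁ * y + 1ℚ * (c₁ * z))
               (Acoeff≡ (suc n) (suc j) (suc (suc r))) (Acoeff≡ (suc n) (suc j) (suc r)) (logCoeff-1 j n) ⟩
    a₂ * (- σ * J * I′ * c₂ * (h + T₁)) + a₁ * (- σ * J * I′ * c₁ * (h + T₀)) + 1ℚ * (c₁ * (σ * J * (I * h)))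
      ≡⟨ regroup a₂ a₁ σ J I′ c₂ c₁ I h T₁ T₀ ⟩
    - σ * J * ((a₂ * (I′ * c₂)) * (h + T₁) + (a₁ * (I′ * c₁)) * (h + T₀)) + σ * J * (I * c₁) * h
      ≡⟨ cong₃ (λ u v w → - σ * J * (u * (h + T₁) + v * (h + T₀)) + σ * J * (I * w) * h)
               (absorption/! n (suc r)) (absorption/! n r) (pascalℚ n r) ⟩
    - σ * J * ((I * d₁) * (h + T₁) + (I * d₀) * (h + T₀)) + σ * J * (I * (d₀ + d₁)) * h
      ≡⟨ cancel σ J I d₁ d₀ h T₁ T₀ ⟩
    - σ * J * I * d₁ * T₁ + - σ * J * I * d₀ * T₀
      ≡⟨ cong₂ _+_ (Acoeff≡ n (suc j) (suc r)) (Acoeff≡ n (suc j) r) ⟨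
    Acoeff n (suc j) (suc r) + Acoeff n (suc j) r ∎
    where
    open ≡-Reasoning
    a₂ = ℕ→ℚ (suc (suc r))
    a₁ = ℕ→ℚ (suc r)
    c₂ = ℕ→ℚ (suc n C suc (suc r))
    c₁ = ℕ→ℚ (suc n C suc r)
    d₁ = ℕ→ℚ (n C suc r)
    d₀ = ℕ→ℚ (n C r)
    T₁ = harmonicTail (suc j) n (suc r)
    T₀ = harmonicTail (suc j) n r
    regroup : ∀ a₂ a₁ σ J I′ c₂ c₁ I h T₁ T₀ →
              a₂ * (- σ * J * I′ * c₂ * (h + T₁)) + a₁ * (- σ * J * I′ * c₁ * (h + T₀)) + 1ℚ * (c₁ * (σ * J * (I * h)))
              ≡ - σ * J * ((a₂ * (I′ * c₂)) * (h + T₁) + (a₁ * (I′ * c₁)) * (h + T₀)) + σ * J * (I * c₁) * h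
    regroup = solve-∀ ℚ-ring
    cancel : ∀ σ J I d₁ d₀ h T₁ T₀ →
             - σ * J * ((I * d₁) * (h + T₁) + (I * d₀) * (h + T₀)) + σ * J * (I * (d₀ + d₁)) * h
             ≡ - σ * J * I * d₁ * T₁ + - σ * J * I * d₀ * T₀
    cancel = solve-∀ ℚ-ring

logCoeff-initial : ∀ j k → logCoeff j 0 (suc k) ≡ Lpow j 0 (suc k)
logCoeff-initial j k with suc k ℕ.≟ j
... | yes refl   = logCoeff-diag (suc k) 0
... | no 1+k≢j with ℕ.<-cmp (suc k) j
...   | tri< 1+k<j _ _ = trans (logCoeff-< 0 1+k<j) (*-zeroʳ (- sgn (j ∸ suc (suc k)) * ℕ→ℚ (j !) * inv (suc k !)))
...   | tri≈ _ 1+k≡j _ = contradiction 1+k≡j 1+k≢j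
...   | tri> _ _ j<1+k = logCoeff-> 0 j<1+k

closedForm-initial : ∀ j r k → closedForm (suc j) 0 r k ≡ Lpow (suc j) r k
closedForm-initial j zero    zero    = refl
closedForm-initial j (suc r) zero    = refl
closedForm-initial j zero    (suc k) = trans (*-identityˡ _) (logCoeff-initial (suc j) k)
closedForm-initial j (suc r) (suc k) = *-zeroˡ (logCoeff (suc j) 0 (suc k))

closedForm-finite : ∀ j n → FiniteSupport (closedForm j n)
closedForm-finite j n = suc (n ℕ.+ j) , outside
  where
  outside : ∀ r k → suc (n ℕ.+ j) ≤ r ⊎ suc (n ℕ.+ j) ≤ k → closedForm j n r k ≡ 0ℚ
  outside (suc r) zero    (inj₁ N≤r)   = if-≤ᵇ-no (ℕ.≤-trans (ℕ.s≤s (ℕ.m≤m+n n j)) N≤r)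
  outside r       (suc k) (inj₁ N≤r)   =
    trans (cong (λ b → ℕ→ℚ b * logCoeff j n (suc k)) (k>n⇒nCk≡0 (ℕ.≤-trans (ℕ.s≤s (ℕ.m≤m+n n j)) N≤r)))
          (*-zeroˡ (logCoeff j n (suc k)))
  outside r       (suc k) (inj₂ N≤1+k) =
    trans (cong (ℕ→ℚ (n C r) *_) (logCoeff-> n (ℕ.≤-trans (ℕ.s≤s (ℕ.m≤n+m j n)) N≤1+k))) (*-zeroʳ (ℕ→ℚ (n C r)))

closedForm-isIntegralFamily : ∀ j → IsIntegralFamily (suc j) (closedForm (suc j))
closedForm-isIntegralFamily j = closedForm-finite (suc j) , closedForm-initial j , D1x≡mul1x , λ _ → refl
  where
  D1x≡mul1x : ∀ n r k → D1x (closedForm (suc j) (suc n)) r k ≡ mul1x (closedForm (suc j) n) r k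
  D1x≡mul1x n zero    zero    = closedForm-D1x-constant j n
  D1x≡mul1x n (suc r) zero    = closedForm-D1x-poly j n r
  D1x≡mul1x n r       (suc k) = closedForm-D1x-log (suc j) n r k

theorem5p4 : (j : ℕ) → j ≥ 1 → (F : ℕ → Expr) → IsIntegralFamily j F →
    (n r : ℕ) → F n r 0 ≡ Acoeff n j r
theorem5p4 (suc j) _ F isF n r = integralFamily-unique isF (closedForm-isIntegralFamily j) n r 0
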